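{- For all integers $k\ge 2$ and $t_k\ge \cdots\ge t_1\ge 3$, every $(K_{t_1},\ldots,K_{t_k})$-co-critical graph has minimum degree at least $t_k-2k-1+\sum_{i=1}^k t_i$.
   Context: All graphs are finite, simple and undirected. For graphs $G,H_1,\ldots,H_k$, write $G\rightarrow(H_1,\ldots,H_k)$ if every edge coloring $\tau:E(G)\to[k]=\{1,\ldots,k\}$ contains, for some $i\in[k]$, a copy of $H_i$ all of whose edges have color $i$. A non-complete graph $G$ is $(H_1,\ldots,H_k)$-co-critical if $G\not\rightarrow(H_1,\ldots,H_k)$ but $G+e\rightarrow(H_1,\ldots,H_k)$ for every edge $e$ of the complement $\overline{G}$, where $G+e$ denotes $G$ with the edge $e$ added. $K_t$ denotes the complete graph on $t$ vertices. -}

module Defs where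

open import Data.Nat using (ℕ; zero; suc; _≤_; _<_; _∸_; s≤s; z≤n)
open import Data.Nat.Properties using (≤-refl)
open import Data.Fin using (Fin; fromℕ<)
open import Data.Bool using (Bool; true; false; _∨_; _∧_; if_then_else_)
open import Data.List using (map; allFin)
open import Data.Nat.ListAction using (sum)
open import Data.Product using (Σ; ∃; ∃-syntax; _×_)
open import Relation.Nullary using (¬_; does; yes; no)
open import Data.Empty using (⊥-elim)
open import Relation.Binary.PropositionalEquality using (_≡_; refl; cong₂)
open import Function.Definitions using (Injective)
open import Data.Fin using (_≟_)

record Graph (n : ℕ) : Set where
  field
    adj    : Fin n → Fin n → Bool
    sym    : ∀ u v → adj u v ≡ adj v u
    irrefl : ∀ u → adj u u ≡ false
open Graph public

degree : ∀ {n} → Graph n → Fin n → ℕ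
degree {n} G u = sum (map (λ v → if adj G u v then 1 else 0) (allFin n))

minDegree≥ : ∀ {n} → Graph n → ℕ → Set
minDegree≥ G m = ∀ u → m ≤ degree G u

NonComplete : ∀ {n} → Graph n → Set
NonComplete {n} G = ∃[ u ] ∃[ v ] (¬ u ≡ v × adj G u v ≡ false)

-- An edge colouring with k colours: a symmetric map on pairs of vertices
-- (only its values on edges matter).
record Colouring {n} (G : Graph n) (k : ℕ) : Set where
  field
    col    : Fin n → Fin n → Fin k
    colSym : ∀ u v → col u v ≡ col v u
open Colouring public

MonoClique : ∀ {n k} (G : Graph n) → Colouring G k → (t : ℕ) → Fin k → Set
MonoClique {n} G c t i =
  Σ (Fin t → Fin n) λ f → Injective _≡_ _≡_ f ×
    (∀ a b → ¬ a ≡ b → adj G (f a) (f b) ≡ true × col c (f a) (f b) ≡ i)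

Arrows : ∀ {n k} → Graph n → (Fin k → ℕ) → Set
Arrows {k = k} G ts = (c : Colouring G k) → ∃[ i ] MonoClique G c (ts i) i

isPair : ∀ {n} → Fin n → Fin n → Fin n → Fin n → Bool
isPair u v x y = (does (x ≟ u) ∧ does (y ≟ v)) ∨ (does (x ≟ v) ∧ does (y ≟ u))

isPair-sym : ∀ {n} (u v x y : Fin n) → isPair u v x y ≡ isPair u v y x
isPair-sym u v x y with x ≟ u | y ≟ v | x ≟ v | y ≟ u
... | yes _ | yes _ | yes _ | yes _ = refl
... | yes _ | yes _ | yes _ | no  _ = refl
... | yes _ | yes _ | no  _ | yes _ = refl
... | yes _ | yes _ | no  _ | no  _ = refl
... | yes _ | no  _ | yes _ | yes _ = refl
... | yes _ | no  _ | yes _ | no  _ = refl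
... | yes _ | no  _ | no  _ | yes _ = refl
... | yes _ | no  _ | no  _ | no  _ = refl
... | no  _ | yes _ | yes _ | yes _ = refl
... | no  _ | yes _ | yes _ | no  _ = refl
... | no  _ | yes _ | no  _ | yes _ = refl
... | no  _ | yes _ | no  _ | no  _ = refl
... | no  _ | no  _ | yes _ | yes _ = refl
... | no  _ | no  _ | yes _ | no  _ = refl
... | no  _ | no  _ | no  _ | yes _ = refl
... | no  _ | no  _ | no  _ | no  _ = refl

isPair-irrefl : ∀ {n} (u v x : Fin n) → ¬ u ≡ v → isPair u v x x ≡ false
isPair-irrefl u v x u≢v with x ≟ u | x ≟ v
... | yes refl | yes refl = ⊥-elim (u≢v refl)
... | yes _    | no  _    = refl
... | no  _    | yes _    = refl
... | no  _    | no  _    = refl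

addEdge : ∀ {n} (G : Graph n) (u v : Fin n) → ¬ u ≡ v → Graph n
addEdge G u v u≢v = record
  { adj    = λ x y → adj G x y ∨ isPair u v x y
  ; sym    = λ x y → cong₂ _∨_ (sym G x y) (isPair-sym u v x y)
  ; irrefl = λ x → cong₂ _∨_ (irrefl G x) (isPair-irrefl u v x u≢v)
  }

CoCritical : ∀ {n k} → Graph n → (Fin k → ℕ) → Set
CoCritical G ts =
  NonComplete G × ¬ Arrows G ts ×
  (∀ u v → (u≢v : ¬ u ≡ v) → adj G u v ≡ false → Arrows (addEdge G u v u≢v) ts)

lastIdx : (k : ℕ) → 2 ≤ k → Fin k
lastIdx (suc k) _ = fromℕ< {k} (s≤s ≤-refl)

{-# OPTIONS --safe #-}
-- Write a i = t i − 2. Given a good colouring of G and non-adjacent x, y, any way of recolouring the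
-- edges at x without creating a forbidden clique leaves, for every colour i, a clique on a i
-- vertices of colour i inside N_i(x) ∩ N_i(y); otherwise xy could be added in colour i.
-- If |N_i(x)| < 2 (a i), then by Hajnal's lemma all these a i-cliques in N_i(x) share a vertex, a
-- pivot. Two pivots v of N_i and w of N_j are impossible, because vw fails to have one of the colours
-- i, j, and then one of them can be moved to the other part. A pivot of N_j has a neighbour of colour
-- i in N_i, or it could be moved there; that neighbour can be moved into N_j, so the parts can be
-- balanced. This shows |N_i| + |N_j| ≥ 2 (a i) + 2 (a j) − 1 for i ≠ j, hence deg x ≥ 2 Σ a − 1.
-- That suffices unless k = 2 and a i = 1 for one colour i, where the bound is short by one. There red
-- (triangle) and blue are played against each other: recolouring x so that it has exactly one red
-- neighbour w, every non-neighbour of x is red to w, and switching one edge at y gives a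
-- contradiction.
module Submission where

open import Defs
open import Data.Bool as Bool using (Bool; true; false; if_then_else_)
open import Data.Nat using (ℕ; zero; suc; _≤_; _<_; _+_; _*_; _∸_; z≤n; s≤s; s≤s⁻¹; _≤?_; _<?_)
open import Data.Nat.Properties hiding (_≟_; suc-injective)
open import Data.Nat.Solver using (module +-*-Solver)
open import Data.Fin using (Fin; zero; suc; _≟_; punchIn) renaming (_≤_ to _≤ᶠ_)
open import Data.Fin.Properties as Fin using (all?; any?; punchInᵢ≢i)
open import Data.Fin.Subset as Subset using (Subset; inside; outside; _∈_; _∉_; _⊆_; _∪_; _∩_; _-_; ⁅_⁆; Nonempty)
  renaming (∣_∣ to size)
open import Data.Fin.Subset.Properties
open import Data.List as List using (map; allFin)
open import Data.List.Properties using (map-tabulate)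
open import Data.Nat.ListAction using (sum)
open import Data.Product using (∃-syntax; _×_; _,_; proj₁; proj₂)
open import Data.Sum using (_⊎_; inj₁; inj₂; [_,_]′)
open import Data.Empty using (⊥; ⊥-elim)
open import Data.Vec as Vec using ([]; _∷_; here; there)
open import Data.Vec.Properties using (lookup∘tabulate; lookup⇒[]=; []=⇒lookup)
open import Function using (_∘_; id)
open import Function.Definitions using (Injective)
open import Relation.Nullary using (¬_; Dec; yes; no; does; contradiction)
open import Relation.Nullary.Decidable using (_×-dec_; _→-dec_; ¬?; dec-true; decidable-stable; map′)
open import Relation.Binary.PropositionalEquality using (_≡_; _≢_; refl; cong; cong₂; subst; subst₂; trans; ≢-sym)
  renaming (sym to ≡-sym)

open import Algebra.Properties.CommutativeMonoid.Sum +-0-commutativeMonoid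
  using (sum-remove; ∑-distrib-+; sum-cong-≗; sum-replicate-zero)
  renaming (sum to ∑)

open +-*-Solver using (solve; _:+_; _:*_; _:=_; con)

private variable
  n k : ℕ

-- Sizes of finite subsets and selection by a decidable predicate.

∣p∪q∣+∣p∩q∣≡∣p∣+∣q∣ : (p q : Subset n) → size (p ∪ q) + size (p ∩ q) ≡ size p + size q
∣p∪q∣+∣p∩q∣≡∣p∣+∣q∣ [] [] = refl
∣p∪q∣+∣p∩q∣≡∣p∣+∣q∣ (outside ∷ p) (outside ∷ q) = ∣p∪q∣+∣p∩q∣≡∣p∣+∣q∣ p q
∣p∪q∣+∣p∩q∣≡∣p∣+∣q∣ (outside ∷ p) (inside ∷ q) =
  trans (cong suc (∣p∪q∣+∣p∩q∣≡∣p∣+∣q∣ p q)) (≡-sym (+-suc (size p) (size q)))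
∣p∪q∣+∣p∩q∣≡∣p∣+∣q∣ (inside ∷ p) (outside ∷ q) = cong suc (∣p∪q∣+∣p∩q∣≡∣p∣+∣q∣ p q)
∣p∪q∣+∣p∩q∣≡∣p∣+∣q∣ (inside ∷ p) (inside ∷ q) = cong suc
  (trans (+-suc (size (p ∪ q)) (size (p ∩ q)))
  (trans (cong suc (∣p∪q∣+∣p∩q∣≡∣p∣+∣q∣ p q)) (≡-sym (+-suc (size p) (size q)))))

∣p∪q∣≤∣p∣+∣q∣ : (p q : Subset n) → size (p ∪ q) ≤ size p + size q
∣p∪q∣≤∣p∣+∣q∣ p q = subst (size (p ∪ q) ≤_) (∣p∪q∣+∣p∩q∣≡∣p∣+∣q∣ p q) (m≤m+n _ _)

x∈p⇒1+∣p-x∣≡∣p∣ : {p : Subset n} {x : Fin n} → x ∈ p → suc (size (p - x)) ≡ size p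
x∈p⇒1+∣p-x∣≡∣p∣ {p = _ ∷ p} here = cong (suc ∘ size) (p─⊥≡p p)
x∈p⇒1+∣p-x∣≡∣p∣ {p = inside ∷ p} (there x∈p) = cong suc (x∈p⇒1+∣p-x∣≡∣p∣ x∈p)
x∈p⇒1+∣p-x∣≡∣p∣ {p = outside ∷ p} (there x∈p) = x∈p⇒1+∣p-x∣≡∣p∣ x∈p

x∉p-x : (p : Subset n) {x : Fin n} → x ∉ p - x
x∉p-x (_ ∷ p) {zero} ()
x∉p-x (_ ∷ p) {suc x} (there x∈) = x∉p-x p x∈

x∈p-y⇒x∈p : {p : Subset n} {x y : Fin n} → x ∈ p - y → x ∈ p
x∈p-y⇒x∈p {p = p} {y = y} = p─q⊆p p ⁅ y ⁆

x∈p-y⇒x≢y : {p : Subset n} {x y : Fin n} → x ∈ p - y → x ≢ y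
x∈p-y⇒x≢y {p = p} x∈ refl = x∉p-x p x∈

1≤∣p∣⇒nonempty : {p : Subset n} → 1 ≤ size p → Nonempty p
1≤∣p∣⇒nonempty {n} {p} 1≤∣p∣ with nonempty? p
... | yes ne = ne
... | no ¬ne = contradiction (subst (1 ≤_) (trans (cong size (Empty-unique ¬ne)) (∣⊥∣≡0 n)) 1≤∣p∣) λ ()

select : {P : Fin n → Set} → (∀ v → Dec (P v)) → Subset n
select P? = Vec.tabulate (does ∘ P?)

∈-select⁺ : {P : Fin n → Set} (P? : ∀ v → Dec (P v)) {v : Fin n} → P v → v ∈ select P?
∈-select⁺ P? {v} Pv = lookup⇒[]= v _ (trans (lookup∘tabulate (does ∘ P?) v) (dec-true (P? v) Pv))

∈-select⁻ : {P : Fin n → Set} (P? : ∀ v → Dec (P v)) {v : Fin n} → v ∈ select P? → P v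
∈-select⁻ P? {v} v∈ with P? v | trans (≡-sym (lookup∘tabulate (does ∘ P?) v)) ([]=⇒lookup v∈)
... | yes Pv | _ = Pv
... | no _   | ()

-- Cliques and Hajnal's lemma.

Clique : (Fin n → Fin n → Set) → Subset n → Set
Clique E K = ∀ {u v} → u ∈ K → v ∈ K → u ≢ v → E u v

clique? : {E : Fin n → Fin n → Set} → (∀ u v → Dec (E u v)) → ∀ K → Dec (Clique E K)
clique? E? K = map′ (λ c {u} {v} → c u v) (λ c u v → c)
  (all? λ u → all? λ v → (u ∈? K) →-dec ((v ∈? K) →-dec (¬? (u ≟ v) →-dec E? u v)))

clique-⊆ : {E : Fin n → Fin n → Set} {K L : Subset n} → K ⊆ L → Clique E L → Clique E K
clique-⊆ K⊆L cl u∈ v∈ = cl (K⊆L u∈) (K⊆L v∈)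

-- The count for `hajnal-step`: `i`, `u`, `k` are the sizes of `I`, `U`, `K`, and `d`, `m`, `m′`,
-- `c`, `w` those of `I ∪ (U ∩ K)`, `I ∩ (U ∩ K)`, `I ∩ K`, `U ∩ K`, `U ∪ K`. Adding `c + a` to both
-- sides avoids subtraction.
hajnal-arith : ∀ a i u k d m m′ c w → a + a ≤ i + u → a ≤ k → d + m ≡ i + c → m ≤ m′ →
        d ≤ a → w + c ≡ u + k → (a + a) + (c + a) ≤ (m′ + w) + (c + a)
hajnal-arith a i u k d m m′ c w total a≤k eq₁ m≤m′ d≤a eq₂ = begin
  (a + a) + (c + a)   ≤⟨ +-mono-≤ total (+-monoʳ-≤ c a≤k) ⟩
  (i + u) + (c + k)   ≡⟨ solve 4 (λ i u c k → (i :+ u) :+ (c :+ k) := (i :+ c) :+ (u :+ k)) refl i u c k ⟩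
  (i + c) + (u + k)   ≡⟨ cong₂ _+_ eq₁ eq₂ ⟨
  (d + m) + (w + c)   ≤⟨ +-monoˡ-≤ (w + c) (+-mono-≤ d≤a m≤m′) ⟩
  (a + m′) + (w + c)  ≡⟨ solve 4 (λ a m w c → (a :+ m) :+ (w :+ c) := (m :+ w) :+ (c :+ a)) refl a m′ w c ⟩
  (m′ + w) + (c + a)  ∎
  where open ≤-Reasoning

-- Hajnal: for a family of maximum cliques with intersection I and union U, |I| + |U| ≥ 2a,
-- because I ∪ (U ∩ K) is again a clique for every further member K.
module _ {E : Fin n → Fin n → Set} (E? : ∀ u v → Dec (E u v)) (E-sym : ∀ {u v} → E u v → E v u)
         {a : ℕ} {S : Subset n} (bounded : ∀ {K} → K ⊆ S → Clique E K → size K ≤ a) where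

  hajnal-step : ∀ {I U K} → I ⊆ U → U ⊆ S → (∀ {u v} → u ∈ I → v ∈ U → u ≢ v → E u v) →
    a + a ≤ size I + size U → K ⊆ S → Clique E K → a ≤ size K → a + a ≤ size (I ∩ K) + size (U ∪ K)
  hajnal-step {I} {U} {K} I⊆U U⊆S joined total K⊆S K-clique a≤K =
    +-cancelʳ-≤ (size (U ∩ K) + a) (a + a) (size (I ∩ K) + size (U ∪ K))
      (hajnal-arith a (size I) (size U) (size K) (size D) (size (I ∩ (U ∩ K))) (size (I ∩ K)) (size (U ∩ K)) (size (U ∪ K))
        total a≤K (∣p∪q∣+∣p∩q∣≡∣p∣+∣q∣ I (U ∩ K)) (p⊆q⇒∣p∣≤∣q∣ I∩U∩K⊆I∩K)
        (bounded D⊆S D-clique) (∣p∪q∣+∣p∩q∣≡∣p∣+∣q∣ U K))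
    where
    D = I ∪ (U ∩ K)

    D⊆S : D ⊆ S
    D⊆S v∈D with x∈p∪q⁻ I (U ∩ K) v∈D
    ... | inj₁ v∈I = U⊆S (I⊆U v∈I)
    ... | inj₂ v∈UK = K⊆S (p∩q⊆q U K v∈UK)

    D-clique : Clique E D
    D-clique u∈D v∈D u≢v with x∈p∪q⁻ I (U ∩ K) u∈D | x∈p∪q⁻ I (U ∩ K) v∈D
    ... | inj₁ u∈I  | inj₁ v∈I  = joined u∈I (I⊆U v∈I) u≢v
    ... | inj₁ u∈I  | inj₂ v∈UK = joined u∈I (p∩q⊆p U K v∈UK) u≢v
    ... | inj₂ u∈UK | inj₁ v∈I  = E-sym (joined v∈I (p∩q⊆p U K u∈UK) (≢-sym u≢v))
    ... | inj₂ u∈UK | inj₂ v∈UK = K-clique (p∩q⊆q U K u∈UK) (p∩q⊆q U K v∈UK) u≢v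

    I∩U∩K⊆I∩K : I ∩ (U ∩ K) ⊆ I ∩ K
    I∩U∩K⊆I∩K v∈ with x∈p∩q⁻ I (U ∩ K) v∈
    ... | v∈I , v∈UK = x∈p∩q⁺ (v∈I , p∩q⊆q U K v∈UK)

  hajnal : size S < a + a → ∀ {K₀} → K₀ ⊆ S → Clique E K₀ → a ≤ size K₀ →
    ∃[ v ] v ∈ S × (∀ {K} → K ⊆ S → Clique E K → a ≤ size K → v ∈ K)
  hajnal small {K₀} K₀⊆S K₀-clique a≤K₀ =
    loop (size K₀) K₀ K₀ ≤-refl id K₀⊆S K₀-clique (+-mono-≤ a≤K₀ a≤K₀)
    where
    missing? : ∀ I → Dec (∃[ K ] K ⊆ S × Clique E K × a ≤ size K × ∃[ v ] v ∈ I × v ∉ K)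
    missing? I = anySubset? λ K → (K ⊆? S) ×-dec (clique? E? K ×-dec ((a ≤? size K) ×-dec
      any? λ v → (v ∈? I) ×-dec ¬? (v ∈? K)))

    -- A large clique missing a vertex of `I` strictly shrinks `I`, so `m` bounds the number of
    -- rounds. When no such clique is left, any vertex of `I` is a pivot.
    loop : ∀ m I U → size I ≤ m → I ⊆ U → U ⊆ S → (∀ {u v} → u ∈ I → v ∈ U → u ≢ v → E u v) →
      a + a ≤ size I + size U → ∃[ v ] v ∈ S × (∀ {K} → K ⊆ S → Clique E K → a ≤ size K → v ∈ K)
    loop m I U I≤m I⊆U U⊆S joined total with missing? I
    ... | no none = v , U⊆S (I⊆U v∈I) , λ {K} K⊆S cl a≤K → decidable-stable (v ∈? K)
            λ v∉K → none (K , K⊆S , cl , a≤K , v , v∈I , v∉K)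
      where
      -- `U` lies in `S` and has fewer than `a + a` vertices, so the invariant `total` leaves at
      -- least one for `I`.
      1≤∣I∣ : 1 ≤ size I
      1≤∣I∣ = +-cancelʳ-≤ (size U) 1 (size I) (≤-trans (s≤s (p⊆q⇒∣p∣≤∣q∣ U⊆S)) (≤-trans small total))
      v = proj₁ (1≤∣p∣⇒nonempty 1≤∣I∣)
      v∈I = proj₂ (1≤∣p∣⇒nonempty 1≤∣I∣)
    ... | yes (K , K⊆S , cl , a≤K , v , v∈I , v∉K) = descend m I≤m
      where
      shrinks : size (I ∩ K) < size I
      shrinks = p⊂q⇒∣p∣<∣q∣ (p∩q⊆p I K , v , v∈I , v∉K ∘ p∩q⊆q I K)

      joined′ : ∀ {u w} → u ∈ I ∩ K → w ∈ U ∪ K → u ≢ w → E u w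
      joined′ u∈ w∈ u≢w with x∈p∩q⁻ I K u∈ | x∈p∪q⁻ U K w∈
      ... | u∈I , _ | inj₁ w∈U = joined u∈I w∈U u≢w
      ... | _ , u∈K | inj₂ w∈K = cl u∈K w∈K u≢w

      descend : ∀ m → size I ≤ m → _
      descend zero I≤0 = contradiction (≤-trans shrinks I≤0) λ ()
      descend (suc m) I≤m = loop m (I ∩ K) (U ∪ K) (s≤s⁻¹ (≤-trans shrinks I≤m))
        (p⊆p∪q K ∘ I⊆U ∘ p∩q⊆p I K) ([ U⊆S , K⊆S ]′ ∘ x∈p∪q⁻ U K) joined′
        (hajnal-step I⊆U U⊆S joined total K⊆S cl a≤K)

-- Partitions of a vertex set into colour classes.

opaque
  part : Subset n → (Fin n → Fin k) → Fin k → Subset n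
  part N p i = select λ v → (v ∈? N) ×-dec (p v ≟ i)

  ∈part⁺ : ∀ {N : Subset n} {p : Fin n → Fin k} {i v} → v ∈ N → p v ≡ i → v ∈ part N p i
  ∈part⁺ {N = N} {p} {i} v∈N pv≡i = ∈-select⁺ (λ v → (v ∈? N) ×-dec (p v ≟ i)) (v∈N , pv≡i)

  ∈part⁻ : ∀ {N : Subset n} {p : Fin n → Fin k} {i v} → v ∈ part N p i → v ∈ N × p v ≡ i
  ∈part⁻ {N = N} {p} {i} = ∈-select⁻ (λ v → (v ∈? N) ×-dec (p v ≟ i))

reassign : {k : ℕ} → (Fin n → Fin k) → Fin n → Fin k → Fin n → Fin k
reassign p w i v = if does (v ≟ w) then i else p v

reassign-≡ : (p : Fin n → Fin k) (w : Fin n) (i : Fin k) → reassign p w i w ≡ i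
reassign-≡ p w i with w ≟ w
... | yes _ = refl
... | no w≢w = contradiction refl w≢w

reassign-≢ : (p : Fin n → Fin k) {w v : Fin n} (i : Fin k) → v ≢ w → reassign p w i v ≡ p v
reassign-≢ p {w} {v} i v≢w with v ≟ w
... | yes v≡w = contradiction v≡w v≢w
... | no _ = refl

module Partition {n k : ℕ} (E : Fin k → Fin n → Fin n → Set) (E? : ∀ i u v → Dec (E i u v))
  (E-sym : ∀ {i u v} → E i u v → E i v u) (E-unique : ∀ {i j u v} → E i u v → E j u v → i ≡ j)
  (a : Fin k → ℕ) (a≥1 : ∀ i → 1 ≤ a i) (N : Subset n) where

  -- With `N` the neighbourhood of a vertex x and `p v` the colour of the edge xv, this says that no
  -- forbidden clique passes through x: x adds one vertex to a clique in class `i`.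
  Valid : (Fin n → Fin k) → Set
  Valid p = ∀ i {K} → K ⊆ part N p i → Clique (E i) K → size K ≤ a i

  Large : Fin k → Subset n → Set
  Large i S = ∃[ K ] K ⊆ S × Clique (E i) K × a i ≤ size K

  Pivot : (Fin n → Fin k) → Fin k → Fin n → Set
  Pivot p i v = ∀ {K} → K ⊆ part N p i → Clique (E i) K → a i ≤ size K → v ∈ K

  Blocking : (Fin n → Fin k) → Fin k → Fin n → Set
  Blocking p i w = ∀ {K} → K ⊆ part N p i → Clique (E i) K → a i ≤ size K → ∃[ u ] u ∈ K × ¬ E i u w

  large-nonempty : ∀ i {K : Subset n} → a i ≤ size K → Nonempty K
  large-nonempty i a≤K = 1≤∣p∣⇒nonempty (≤-trans (a≥1 i) a≤K)

  -- A new clique must contain `w`. If the rest of it had `a i` vertices, blocking would supply one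
  -- not joined to `w` in colour `i`.
  reassign-valid : ∀ {p} w i → Valid p → Blocking p i w → Valid (reassign p w i)
  reassign-valid {p} w i valid blocking j {K} K⊆ K-clique with w ∈? K
  ... | no w∉K = valid j
          (λ v∈K → let v∈N , pv≡j = ∈part⁻ (K⊆ v∈K)
                   in ∈part⁺ v∈N (trans (≡-sym (reassign-≢ p i λ { refl → w∉K v∈K })) pv≡j)) K-clique
  ... | yes w∈K with trans (≡-sym (reassign-≡ p w i)) (proj₂ (∈part⁻ (K⊆ w∈K)))
  ... | refl = subst (_≤ a i) (x∈p⇒1+∣p-x∣≡∣p∣ w∈K) (≰⇒> not-large)
    where
    K-w⊆ : K - w ⊆ part N p i
    K-w⊆ v∈ = let v∈N , pv≡i = ∈part⁻ (K⊆ (x∈p-y⇒x∈p v∈))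
              in ∈part⁺ v∈N (trans (≡-sym (reassign-≢ p i (x∈p-y⇒x≢y v∈))) pv≡i)

    not-large : ¬ a i ≤ size (K - w)
    not-large a≤ with blocking K-w⊆ (clique-⊆ x∈p-y⇒x∈p K-clique) a≤
    ... | u , u∈ , ¬Euw = ¬Euw (K-clique (x∈p-y⇒x∈p u∈) w∈K (x∈p-y⇒x≢y u∈))

  valid-⊆ : ∀ {p q} → Valid p → (∀ i → part N q i ⊆ part N p i) → Valid q
  valid-⊆ valid q⊆p i K⊆ = valid i (q⊆p i ∘ K⊆)

  module Saturated (saturated : ∀ {p} → Valid p → ∀ i → Large i (part N p i)) where

    pivot : ∀ {p} i → Valid p → size (part N p i) < a i + a i → ∃[ v ] v ∈ part N p i × Pivot p i v
    pivot i valid small with saturated valid i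
    ... | _ , K⊆ , K-clique , a≤K = hajnal (E? i) E-sym (valid i) small K⊆ K-clique a≤K

    -- Class `j` without `w` would still contain a large clique by saturation, and that clique has
    -- to contain the pivot `w`.
    pivot-immovable : ∀ {p i j w} → Valid p → Pivot p j w → i ≢ j → ¬ Valid (reassign p w i)
    pivot-immovable {p} {i} {j} {w} valid pivot-w i≢j valid′ with saturated valid′ j
    ... | K , K⊆ , K-clique , a≤K =
      contradiction (trans (≡-sym (reassign-≡ p w i)) (proj₂ (∈part⁻ (K⊆ (pivot-w K⊆part K-clique a≤K))))) i≢j
      where
      K⊆part : K ⊆ part N p j
      K⊆part {v} v∈K with ∈part⁻ (K⊆ v∈K)
      ... | v∈N , eq with v ≟ w
      ...   | yes _ = contradiction eq i≢j
      ...   | no _  = ∈part⁺ v∈N eq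

    -- Otherwise any vertex of a large `i`-clique, nonempty since `a i` is positive, blocks `v`, and
    -- the pivot could be moved to class `i`.
    pivot-neighbour : ∀ {p i j v} → Valid p → Pivot p j v → i ≢ j → ∃[ u ] u ∈ part N p i × E i v u
    pivot-neighbour {p} {i} {j} {v} valid pivot-v i≢j
      with any? (λ u → (u ∈? part N p i) ×-dec E? i v u)
    ... | yes found = found
    ... | no none = contradiction
          (reassign-valid v i valid λ K⊆ _ a≤K →
            let u , u∈K = large-nonempty i a≤K in u , u∈K , λ Euv → none (u , K⊆ u∈K , E-sym Euv))
          (pivot-immovable valid pivot-v i≢j)

    -- Every large clique of class `j` contains `v`, and `uv` has colour `i` rather than `j`, so `v`
    -- is the blocking vertex.
    pull-valid : ∀ {p i j v u} → Valid p → Pivot p j v → i ≢ j → E i v u → Valid (reassign p u j)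
    pull-valid valid pivot-v i≢j Evu = reassign-valid _ _ valid λ K⊆ K-clique a≤K →
      _ , pivot-v K⊆ K-clique a≤K , λ E′vu → i≢j (E-unique Evu E′vu)

    -- The balancing move: a neighbour of the pivot of the small class `j` is transferred from class
    -- `i` to class `j`.
    pull : ∀ {p i j} → Valid p → size (part N p j) < a j + a j → i ≢ j → ∃[ q ] Valid q
      × size (part N q j) ≤ suc (size (part N p j)) × size (part N q i) < size (part N p i)
    pull {p} {i} {j} valid small i≢j =
      let v , _ , pivot-v = pivot j valid small
          u , u∈ , Evu = pivot-neighbour valid pivot-v i≢j
      in reassign p u j , pull-valid valid pivot-v i≢j Evu ,
         ≤-trans (p⊆q⇒∣p∣≤∣q∣ (grown u)) (≤-trans (∣p∪q∣≤∣p∣+∣q∣ (part N p j) ⁅ u ⁆)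
           (≤-reflexive (trans (cong (size (part N p j) +_) (∣⁅x⁆∣≡1 u)) (+-comm _ 1)))) ,
         p⊂q⇒∣p∣<∣q∣ (shrunk u , u , u∈ ,
           λ u∈′ → i≢j (≡-sym (trans (≡-sym (reassign-≡ p u j)) (proj₂ (∈part⁻ u∈′)))))
      where
      grown : ∀ u → part N (reassign p u j) j ⊆ part N p j ∪ ⁅ u ⁆
      grown u {v} v∈ with ∈part⁻ v∈
      ... | v∈N , eq with v ≟ u
      ...   | yes refl = x∈p∪q⁺ (inj₂ (x∈⁅x⁆ u))
      ...   | no _ = x∈p∪q⁺ (inj₁ (∈part⁺ v∈N eq))

      shrunk : ∀ u → part N (reassign p u j) i ⊆ part N p i
      shrunk u {v} v∈ with ∈part⁻ v∈
      ... | v∈N , eq with v ≟ u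
      ...   | yes _ = contradiction (≡-sym eq) i≢j
      ...   | no _ = ∈part⁺ v∈N eq

    -- If `vw` lacked colour `i`, then `v` would block all large `i`-cliques and `w` could leave its
    -- class.
    pivots-joined : ∀ {p i j v w} → Valid p → Pivot p i v → Pivot p j w → i ≢ j → E i v w
    pivots-joined {p} {i} {j} {v} {w} valid pivot-v pivot-w i≢j = decidable-stable (E? i v w) λ ¬Evw →
      pivot-immovable valid pivot-w i≢j (reassign-valid w i valid λ K⊆ K-clique a≤K →
        v , pivot-v K⊆ K-clique a≤K , ¬Evw)

    not-both-small : ∀ {p i j} → Valid p → i ≢ j → size (part N p i) < a i + a i →
      size (part N p j) < a j + a j → ⊥
    not-both-small {p} {i} {j} valid i≢j small-i small-j =
      let v , _ , pivot-v = pivot i valid small-i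
          w , _ , pivot-w = pivot j valid small-j
      in i≢j (E-unique (pivots-joined valid pivot-v pivot-w i≢j)
           (E-sym (pivots-joined valid pivot-w pivot-v (≢-sym i≢j))))

    pair-bound : ∀ {p i j} → Valid p → i ≢ j →
      (a i + a i) + (a j + a j) ≤ suc (size (part N p i) + size (part N p j))
    pair-bound {p} {i} {j} valid i≢j = ≮⇒≥ λ short → case-small valid i≢j short
      where
      -- Vertices are pulled from `i` into the small class `j` until both are small, which is
      -- impossible; `m` bounds the size of class `i`.
      drain : ∀ m {p i j} → Valid p → i ≢ j → size (part N p i) ≤ m → size (part N p j) < a j + a j →
        suc (size (part N p i) + size (part N p j)) < (a i + a i) + (a j + a j) → ⊥
      drain m {p} {i} {j} valid i≢j i≤m small-j short with size (part N p i) <? a i + a i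
      ... | yes small-i = not-both-small valid i≢j small-i small-j
      ... | no ¬small-i with pull valid small-j i≢j | m
      ...   | _ , _ , _ , i< | zero = contradiction (≤-trans i< i≤m) λ ()
      ...   | q , valid-q , j≤ , i< | suc m′ =
        drain m′ valid-q i≢j (s≤s⁻¹ (≤-trans i< i≤m)) (≤-<-trans j≤ room)
          (≤-<-trans (≤-trans (+-mono-≤ i< j≤) (≤-reflexive (+-suc _ _))) short)
        where
        -- Class `i` still has at least `a i + a i` vertices, so the shortage of two in the total
        -- falls on class `j`, which stays small after gaining one vertex.
        room : suc (size (part N p j)) < a j + a j
        room = +-cancelˡ-< (a i + a i) _ _
          (≤-<-trans (≤-trans (≤-reflexive (+-suc _ _)) (s≤s (+-monoˡ-≤ _ (≮⇒≥ ¬small-i)))) short)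

      case-small : ∀ {p i j} → Valid p → i ≢ j →
        suc (size (part N p i) + size (part N p j)) < (a i + a i) + (a j + a j) → ⊥
      case-small {p} {i} {j} valid i≢j short with size (part N p j) <? a j + a j
      ... | yes small-j = drain _ valid i≢j ≤-refl small-j short
      ... | no ¬small-j with size (part N p i) <? a i + a i
      ...   | yes small-i = drain _ valid (≢-sym i≢j) ≤-refl small-i
                (subst₂ (λ x y → suc x < y) (+-comm (size (part N p i)) _) (+-comm (a i + a i) _) short)
      ...   | no ¬small-i = <⇒≱ short (m≤n⇒m≤1+n (+-mono-≤ (≮⇒≥ ¬small-i) (≮⇒≥ ¬small-j)))

-- Sums over colours.

∑-mono-≤ : ∀ {m} {f g : Fin m → ℕ} → (∀ i → f i ≤ g i) → ∑ f ≤ ∑ g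
∑-mono-≤ {zero} f≤g = z≤n
∑-mono-≤ {suc m} f≤g = +-mono-≤ (f≤g zero) (∑-mono-≤ (f≤g ∘ suc))

sum-map-allFin : ∀ {m} (f : Fin m → ℕ) → sum (map f (allFin m)) ≡ ∑ f
sum-map-allFin f = trans (cong sum (map-tabulate id f)) (sum-tabulate f)
  where
  sum-tabulate : ∀ {m} (f : Fin m → ℕ) → sum (List.tabulate f) ≡ ∑ f
  sum-tabulate {zero} f = refl
  sum-tabulate {suc m} f = cong (f zero +_) (sum-tabulate (f ∘ suc))

size-∷ : ∀ s (p : Subset n) → size (s ∷ p) ≡ (if s then 1 else 0) + size p
size-∷ true p = refl
size-∷ false p = refl

∑-indicator : (j : Fin k) → ∑ (λ i → if does (j ≟ i) then 1 else 0) ≡ 1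
∑-indicator {suc k} zero = cong suc (sum-replicate-zero k)
∑-indicator {suc k} (suc j) = ∑-indicator j

opaque
  unfolding part

  ∑-part : (N : Subset n) (p : Fin n → Fin k) → ∑ (λ i → size (part N p i)) ≡ size N
  ∑-part {k = k} [] p = sum-replicate-zero k
  ∑-part (outside ∷ N) p = ∑-part N (p ∘ suc)
  ∑-part (inside ∷ N) p =
    trans (sum-cong-≗ λ i → size-∷ (does (p zero ≟ i)) (part N (p ∘ suc) i))
    (trans (∑-distrib-+ (λ i → if does (p zero ≟ i) then 1 else 0) (λ i → size (part N (p ∘ suc) i)))
    (cong₂ _+_ (∑-indicator (p zero)) (∑-part N (p ∘ suc))))

-- Two indices with `s < f` would lose 2 as a pair. So at most one index is deficient, and pairing
-- it with any other limits the total loss to 1.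
∑-pair-bound : ∀ {m} (f s : Fin (2 + m) → ℕ) → (∀ {i j} → i ≢ j → f i + f j ≤ suc (s i + s j)) →
  ∑ f ≤ suc (∑ s)
∑-pair-bound f s pair with any? (λ i → s i <? f i)
... | no none = m≤n⇒m≤1+n (∑-mono-≤ λ i → ≮⇒≥ λ s<f → none (i , s<f))
... | yes (i , sᵢ<fᵢ) = begin
  ∑ f                                             ≡⟨ sum-remove {i = i} f ⟩
  f i + (f j + ∑ (λ l → f (punchIn i (suc l))))   ≡⟨ +-assoc (f i) (f j) _ ⟨
  (f i + f j) + ∑ (λ l → f (punchIn i (suc l)))   ≤⟨ +-mono-≤ (pair (≢-sym (punchInᵢ≢i i zero)))
                                                       (∑-mono-≤ λ l → others (punchInᵢ≢i i (suc l))) ⟩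
  suc (s i + s j) + ∑ (λ l → s (punchIn i (suc l))) ≡⟨ cong suc (+-assoc (s i) (s j) _) ⟩
  suc (s i + (s j + ∑ (λ l → s (punchIn i (suc l))))) ≡⟨ cong suc (sum-remove {i = i} s) ⟨
  suc (∑ s) ∎
  where
  open ≤-Reasoning
  j = punchIn i zero

  others : ∀ {l} → l ≢ i → f l ≤ s l
  others {l} l≢i = ≮⇒≥ λ sₗ<fₗ → contradiction
    (≤-trans (+-mono-≤ sᵢ<fᵢ sₗ<fₗ) (pair (≢-sym l≢i))) (<⇒≱ (s≤s (≤-reflexive (≡-sym (+-suc (s i) (s l))))))

-- The terms other than `a l` are positive, so they sum to at least 2 unless there is only one and
-- it equals 1.
surplus : ∀ {m} (a : Fin (2 + m) → ℕ) → (∀ i → 1 ≤ a i) → ∀ l →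
  (m ≡ 0 × a (punchIn l zero) ≡ 1) ⊎ a l + 2 ≤ ∑ a
surplus {m} a a≥1 l with a (punchIn l zero) ≤? 1
... | no a≰1 = inj₂ (subst (a l + 2 ≤_) (≡-sym (sum-remove {i = l} a))
        (+-monoʳ-≤ (a l) (≤-trans (≰⇒> a≰1) (m≤m+n _ _))))
surplus {zero} a a≥1 l | yes a≤1 = inj₁ (refl , ≤-antisym a≤1 (a≥1 _))
surplus {suc m} a a≥1 l | yes a≤1 = inj₂ (subst (a l + 2 ≤_) (≡-sym (sum-remove {i = l} a))
  (+-monoʳ-≤ (a l) (+-mono-≤ (a≥1 (punchIn l zero)) (≤-trans (a≥1 (punchIn l (suc zero))) (m≤m+n _ _)))))

-- Passing between injections and subsets.

embed : ∀ m {K : Subset n} → m ≤ size K →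
  ∃[ f ] Injective {A = Fin m} {B = Fin n} _≡_ _≡_ f × (∀ i → f i ∈ K)
embed zero _ = (λ ()) , (λ { {()} }) , λ ()
embed {n} (suc m) {K} m<K with 1≤∣p∣⇒nonempty {p = K} (≤-trans (s≤s z≤n) m<K)
... | v , v∈K with embed m {K - v} (s≤s⁻¹ (≤-trans m<K (≤-reflexive (≡-sym (x∈p⇒1+∣p-x∣≡∣p∣ v∈K)))))
... | f , f-inj , f∈ = g , (λ {i} {j} → g-inj i j) , g∈
  where
  g : Fin (suc m) → Fin n
  g zero = v
  g (suc i) = f i

  g-inj : ∀ i j → g i ≡ g j → i ≡ j
  g-inj zero zero _ = refl
  g-inj zero (suc j) v≡fj = contradiction (≡-sym v≡fj) (x∈p-y⇒x≢y (f∈ j))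
  g-inj (suc i) zero fi≡v = contradiction fi≡v (x∈p-y⇒x≢y (f∈ i))
  g-inj (suc i) (suc j) fi≡fj = cong suc (f-inj fi≡fj)

  g∈ : ∀ i → g i ∈ K
  g∈ zero = v∈K
  g∈ (suc i) = x∈p-y⇒x∈p (f∈ i)

image : ∀ {m} (f : Fin m → Fin n) → Injective _≡_ _≡_ f →
  ∃[ K ] m ≤ size K × (∀ {v} → v ∈ K → ∃[ i ] f i ≡ v)
image {m = zero} f _ = Subset.⊥ , z≤n , λ v∈⊥ → contradiction v∈⊥ ∉⊥
image {m = suc m} f f-inj with image (f ∘ suc) (Fin.suc-injective ∘ f-inj)
... | K , m≤K , K⊆ = K ∪ ⁅ f zero ⁆ ,
  ≤-trans (s≤s m≤K) (p⊂q⇒∣p∣<∣q∣ (p⊆p∪q _ , f zero , q⊆p∪q K _ (x∈⁅x⁆ _) ,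
    λ f0∈K → let i , eq = K⊆ f0∈K in contradiction (f-inj eq) λ ())) ,
  λ v∈ → [ (λ v∈K → let i , eq = K⊆ v∈K in suc i , eq) ,
           (λ v∈ → zero , ≡-sym (x∈⁅y⁆⇒x≡y _ v∈)) ]′ (x∈p∪q⁻ K _ v∈)

-- Coloured edges, neighbourhoods and degrees.

Edge : Graph n → (Fin n → Fin n → Fin k) → Fin k → Fin n → Fin n → Set
Edge G c i u v = adj G u v ≡ true × c u v ≡ i

edge? : (G : Graph n) (c : Fin n → Fin n → Fin k) (i : Fin k) (u v : Fin n) → Dec (Edge G c i u v)
edge? G c i u v = (adj G u v Bool.≟ true) ×-dec (c u v ≟ i)

nbrs : Graph n → Fin n → Subset n
nbrs G x = Vec.tabulate (adj G x)

∈nbrs⁺ : (G : Graph n) {x v : Fin n} → adj G x v ≡ true → v ∈ nbrs G x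
∈nbrs⁺ G {x} {v} e = lookup⇒[]= v _ (trans (lookup∘tabulate (adj G x) v) e)

∈nbrs⁻ : (G : Graph n) {x v : Fin n} → v ∈ nbrs G x → adj G x v ≡ true
∈nbrs⁻ G {x} {v} v∈ = trans (≡-sym (lookup∘tabulate (adj G x) v)) ([]=⇒lookup v∈)

degree≡size : (G : Graph n) (x : Fin n) → degree G x ≡ size (nbrs G x)
degree≡size {n} G x = trans (sum-map-allFin (λ v → if adj G x v then 1 else 0)) (count (adj G x))
  where
  count : ∀ {m} (f : Fin m → Bool) → ∑ (λ v → if f v then 1 else 0) ≡ size (Vec.tabulate f)
  count {zero} f = refl
  count {suc m} f = trans (cong ((if f zero then 1 else 0) +_) (count (f ∘ suc)))
    (≡-sym (size-∷ (f zero) (Vec.tabulate (f ∘ suc))))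

adj-≢ : (G : Graph n) {u v : Fin n} → adj G u v ≡ true → u ≢ v
adj-≢ G {u} e refl with trans (≡-sym e) (irrefl G u)
... | ()

degree-full : (G : Graph n) (x : Fin n) → (∀ v → x ≢ v → adj G x v ≡ true) → ∀ u → degree G u ≤ degree G x
degree-full {n} G x full u = subst₂ _≤_ (≡-sym (degree≡size G u)) (≡-sym (degree≡size G x))
  (≤-trans (s≤s⁻¹ nbrs<n) n-1≤)
  where
  nbrs<n : size (nbrs G u) < suc (size (Subset.⊤ - x))
  nbrs<n = subst (size (nbrs G u) <_) (≡-sym (x∈p⇒1+∣p-x∣≡∣p∣ {p = Subset.⊤} {x} ∈⊤))
    (p⊂q⇒∣p∣<∣q∣ {p = nbrs G u} {q = Subset.⊤} (⊆⊤ , u , ∈⊤ , λ u∈ → adj-≢ G (∈nbrs⁻ G u∈) refl))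

  n-1≤ : size (Subset.⊤ - x) ≤ size (nbrs G x)
  n-1≤ = p⊆q⇒∣p∣≤∣q∣ {p = Subset.⊤ - x} λ v∈ → ∈nbrs⁺ G (full _ (≢-sym (x∈p-y⇒x≢y {p = Subset.⊤} v∈)))

-- Recolouring one pair and the use of co-criticality.

Pair : Fin n → Fin n → Fin n → Fin n → Set
Pair x y u v = (u ≡ x × v ≡ y) ⊎ (u ≡ y × v ≡ x)

isPair⁻ : (x y u v : Fin n) → isPair x y u v ≡ true → Pair x y u v
isPair⁻ x y u v eq with u ≟ x | v ≟ y | u ≟ y | v ≟ x
... | yes u≡x | yes v≡y | _ | _ = inj₁ (u≡x , v≡y)
... | no _  | _ | yes u≡y | yes v≡x = inj₂ (u≡y , v≡x)
... | yes _ | no _ | yes u≡y | yes v≡x = inj₂ (u≡y , v≡x)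
isPair⁻ x y u v () | no _  | _ | no _ | _
isPair⁻ x y u v () | no _  | _ | yes _ | no _
isPair⁻ x y u v () | yes _  | no _ | no _ | _
isPair⁻ x y u v () | yes _  | no _ | yes _ | no _

isPair-refl : (x y : Fin n) → isPair x y x y ≡ true
isPair-refl x y with x ≟ x | y ≟ y
... | yes _ | yes _ = refl
... | no x≢x | _ = contradiction refl x≢x
... | yes _ | no y≢y = contradiction refl y≢y

recolour : {G : Graph n} → Colouring G k → Fin n → Fin n → Fin k → Fin n → Fin n → Fin k
recolour c x y i u v = if isPair x y u v then i else col c u v

-- The target `H` is free, so the same map serves both for switching an edge of `G` and for
-- colouring an added edge.
recolouring : {G H : Graph n} → Colouring G k → Fin n → Fin n → Fin k → Colouring H k
recolouring c x y i = record
  { col    = recolour c x y i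
  ; colSym = λ u v → cong₂ (λ b j → if b then i else j) (isPair-sym x y u v) (colSym c u v)
  }

recolour-pair : {G : Graph n} (c : Colouring G k) (x y : Fin n) (i : Fin k) → recolour c x y i x y ≡ i
recolour-pair c x y i = cong (λ b → if b then i else col c x y) (isPair-refl x y)

recolour-other : {G : Graph n} (c : Colouring G k) (x y : Fin n) (i : Fin k) {u v : Fin n} →
  Pair x y u v ⊎ recolour c x y i u v ≡ col c u v
recolour-other c x y i {u} {v} with isPair x y u v in eq
... | true = inj₁ (isPair⁻ x y u v eq)
... | false = inj₂ refl

module _ (a : Fin k → ℕ) where

  -- The forbidden cliques have a i + 2 vertices.
  Good : {G : Graph n} → Colouring G k → Set
  Good {G = G} c = ∀ i {K} → Clique (Edge G (col c) i) K → size K ≤ suc (a i)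

  -- The obstruction to giving `xy` colour `i`: together with `x` and `y`, `L` would form a
  -- forbidden clique.
  CommonClique : {G : Graph n} → Colouring G k → Fin k → Fin n → Fin n → Set
  CommonClique {G = G} c i x y = ∃[ L ] Clique (Edge G (col c) i) L × a i ≤ size L
    × (∀ {v} → v ∈ L → Edge G (col c) i x v × Edge G (col c) i y v)

  module _ {G H : Graph n} (c : Colouring G k) (good : Good c) {x y : Fin n} (x≢y : x ≢ y)
    (new : ∀ {u v} → adj H u v ≡ true → adj G u v ≡ true ⊎ Pair x y u v) (i : Fin k) where

    old-or-pair : ∀ {j u v} → Edge H (recolour c x y i) j u v → Edge G (col c) j u v ⊎ Pair x y u v
    old-or-pair (e , eq) with new e | recolour-other c x y i
    ... | inj₂ pair | _ = inj₂ pair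
    ... | inj₁ _    | inj₁ pair = inj₂ pair
    ... | inj₁ e′   | inj₂ same = inj₁ (e′ , trans (≡-sym same) eq)

    -- A forbidden clique missing `x` or `y` would already exist under `c`. Hence it contains both,
    -- its colour is that of `xy`, and removing the two leaves the common clique.
    new-clique : ∀ {j K} → Clique (Edge H (recolour c x y i) j) K → suc (a j) < size K → CommonClique c i x y
    new-clique {j} {K} K-clique big with x ∈? K | y ∈? K
    ... | no x∉K | _ = contradiction (good j λ u∈ v∈ u≢v →
            [ id , (λ { (inj₁ (refl , _)) → contradiction u∈ x∉K ; (inj₂ (_ , refl)) → contradiction v∈ x∉K }) ]′
              (old-or-pair (K-clique u∈ v∈ u≢v))) (<⇒≱ big)
    ... | yes _ | no y∉K = contradiction (good j λ u∈ v∈ u≢v →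
            [ id , (λ { (inj₁ (_ , refl)) → contradiction v∈ y∉K ; (inj₂ (refl , _)) → contradiction u∈ y∉K }) ]′
              (old-or-pair (K-clique u∈ v∈ u≢v))) (<⇒≱ big)
    ... | yes x∈K | yes y∈K with trans (≡-sym (recolour-pair c x y i)) (proj₂ (K-clique x∈K y∈K x≢y))
    ... | refl = L , L-clique , a≤L , λ v∈L →
          old (≢x v∈L) (≢y v∈L) (K-clique x∈K (L⊆K v∈L) (≢-sym (≢x v∈L))) ,
          old (≢x v∈L) (≢y v∈L) (K-clique y∈K (L⊆K v∈L) (≢-sym (≢y v∈L)))
      where
      L = K - x - y

      ≢y : ∀ {v} → v ∈ L → v ≢ y
      ≢y = x∈p-y⇒x≢y

      ≢x : ∀ {v} → v ∈ L → v ≢ x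
      ≢x v∈L = x∈p-y⇒x≢y (x∈p-y⇒x∈p v∈L)

      L⊆K : ∀ {v} → v ∈ L → v ∈ K
      L⊆K v∈L = x∈p-y⇒x∈p (x∈p-y⇒x∈p v∈L)

      old : ∀ {u v} → v ≢ x → v ≢ y → Edge H (recolour c x y i) i u v → Edge G (col c) i u v
      old v≢x v≢y e with old-or-pair e
      ... | inj₁ e′ = e′
      ... | inj₂ (inj₁ (_ , v≡y)) = contradiction v≡y v≢y
      ... | inj₂ (inj₂ (_ , v≡x)) = contradiction v≡x v≢x

      L-clique : Clique (Edge G (col c) i) L
      L-clique u∈ v∈ u≢v = old (≢x v∈) (≢y v∈) (K-clique (L⊆K u∈) (L⊆K v∈) u≢v)

      a≤L : a i ≤ size L
      a≤L = s≤s⁻¹ (s≤s⁻¹ (≤-trans big (≤-reflexive (≡-sym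
        (trans (cong suc (x∈p⇒1+∣p-x∣≡∣p∣ (x∈p∧x≢y⇒x∈p-y y∈K (≢-sym x≢y)))) (x∈p⇒1+∣p-x∣≡∣p∣ x∈K))))))

  recolouring-good : {G : Graph n} {c : Colouring G k} → Good c → ∀ {x y} → x ≢ y → ∀ i →
    ¬ CommonClique c i x y → Good {G = G} (recolouring c x y i)
  recolouring-good {G = G} {c} good x≢y i none j K-clique =
    ≮⇒≥ λ big → none (new-clique {H = G} c good x≢y inj₁ i K-clique big)

  module _ (G : Graph n) {ts : Fin k → ℕ} (ts≡ : ∀ i → ts i ≡ 2 + a i) where

    -- The double negation is enough because the inequality finally proved is decidable.
    good-colouring : ¬ Arrows G ts → ¬ (∀ c → ¬ Good {G = G} c)
    good-colouring ¬arrows none = ¬arrows λ c → arrow c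
      where
      arrow : ∀ c → ∃[ i ] MonoClique G c (ts i) i
      arrow c with any? (λ i → anySubset? λ K → clique? (edge? G (col c) i) K ×-dec (suc (suc (a i)) ≤? size K))
      ... | no ¬mono = ⊥-elim (none c λ i K-clique → ≮⇒≥ λ big → ¬mono (i , _ , K-clique , big))
      ... | yes (i , K , K-clique , big) with embed (ts i) {K} (≤-trans (≤-reflexive (ts≡ i)) big)
      ...   | f , f-inj , f∈K = i , f , f-inj , λ j l j≢l → K-clique (f∈K j) (f∈K l) (j≢l ∘ f-inj)

    critical : ∀ {x y} (x≢y : x ≢ y) → Arrows (addEdge G x y x≢y) ts →
      {c : Colouring G k} → Good c → ∀ i → CommonClique c i x y
    critical {x} {y} x≢y arrows {c} good i with arrows (recolouring c x y i)
    ... | j , f , f-inj , mono with image f f-inj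
    ... | K , ts≤K , K⊆ = new-clique {H = addEdge G x y x≢y} c good x≢y new i K-clique
            (subst (_≤ size K) (ts≡ j) ts≤K)
      where
      new : ∀ {u v} → adj (addEdge G x y x≢y) u v ≡ true → adj G u v ≡ true ⊎ Pair x y u v
      new {u} {v} e with adj G u v | isPair x y u v in eq
      ... | true  | _    = inj₁ refl
      ... | false | true = inj₂ (isPair⁻ x y u v eq)

      K-clique : Clique (Edge (addEdge G x y x≢y) (recolour c x y i) j) K
      K-clique u∈ v∈ u≢v with K⊆ u∈ | K⊆ v∈
      ... | l , refl | m , refl = mono l m λ { refl → u≢v refl }

-- Recolouring all edges at a vertex.

NonNbr : Graph n → Fin n → Fin n → Set
NonNbr G x y = x ≢ y × adj G x y ≡ false

nonNbr-∉ : (G : Graph n) {x y : Fin n} → NonNbr G x y → y ∉ nbrs G x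
nonNbr-∉ G (_ , e) y∈ with trans (≡-sym e) (∈nbrs⁻ G y∈)
... | ()

star : (Fin n → Fin n → Fin k) → Fin n → (Fin n → Fin k) → Fin n → Fin n → Fin k
star c x p u v = if does (u ≟ x) then p v else (if does (v ≟ x) then p u else c u v)

starring : {G : Graph n} → Colouring G k → Fin n → (Fin n → Fin k) → Colouring G k
starring c x p = record { col = star (col c) x p ; colSym = star-sym }
  where
  star-sym : ∀ u v → star (col c) x p u v ≡ star (col c) x p v u
  star-sym u v with u ≟ x | v ≟ x
  ... | yes refl | yes refl = refl
  ... | yes _ | no _ = refl
  ... | no _ | yes _ = refl
  ... | no _ | no _ = colSym c u v

star-at : (c : Fin n → Fin n → Fin k) (x : Fin n) (p : Fin n → Fin k) {v : Fin n} → star c x p x v ≡ p v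
star-at c x p with x ≟ x
... | yes _ = refl
... | no x≢x = contradiction refl x≢x

star-off : (c : Fin n → Fin n → Fin k) {x : Fin n} (p : Fin n → Fin k) {u v : Fin n} →
  u ≢ x → v ≢ x → star c x p u v ≡ c u v
star-off c {x} p {u} {v} u≢x v≢x with u ≟ x | v ≟ x
... | yes u≡x | _ = contradiction u≡x u≢x
... | no _ | yes v≡x = contradiction v≡x v≢x
... | no _ | no _ = refl

module Recolour {n k : ℕ} (G : Graph n) (a : Fin k → ℕ) (a≥1 : ∀ i → 1 ≤ a i)
  (crit : ∀ {x y} → NonNbr G x y → {c : Colouring G k} → Good a c → ∀ i → CommonClique a c i x y)
  (x : Fin n) where

  N : Subset n
  N = nbrs G x

  module _ (c : Colouring G k) where

    E : Fin k → Fin n → Fin n → Set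
    E = Edge G (col c)

    E-sym : ∀ {i u v} → E i u v → E i v u
    E-sym (e , eq) = trans (sym G _ _) e , trans (colSym c _ _) eq

    E-unique : ∀ {i j u v} → E i u v → E j u v → i ≡ j
    E-unique (_ , eq) (_ , eq′) = trans (≡-sym eq) eq′

    open Partition E (edge? G (col c)) E-sym E-unique a a≥1 N public using (Valid)

  own-valid : ∀ {c} → Good a c → Valid c (col c x)
  own-valid {c} good i {K} K⊆ K-clique = s≤s⁻¹ (≤-trans K<K∪x (good i K∪x-clique))
    where
    x-joined : ∀ {v} → v ∈ K → E c i x v
    x-joined v∈K = let v∈N , eq = ∈part⁻ (K⊆ v∈K) in ∈nbrs⁻ G v∈N , eq

    K<K∪x : size K < size (K ∪ ⁅ x ⁆)
    K<K∪x = p⊂q⇒∣p∣<∣q∣ (p⊆p∪q _ , x , q⊆p∪q K _ (x∈⁅x⁆ x) , λ x∈K → adj-≢ G (proj₁ (x-joined x∈K)) refl)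

    K∪x-clique : Clique (E c i) (K ∪ ⁅ x ⁆)
    K∪x-clique u∈ v∈ u≢v with x∈p∪q⁻ K _ u∈ | x∈p∪q⁻ K _ v∈
    ... | inj₁ u∈K | inj₁ v∈K = K-clique u∈K v∈K u≢v
    ... | inj₁ u∈K | inj₂ v∈x with x∈⁅y⁆⇒x≡y x v∈x
    ...   | refl = E-sym c (x-joined u∈K)
    K∪x-clique u∈ v∈ u≢v | inj₂ u∈x | inj₁ v∈K with x∈⁅y⁆⇒x≡y x u∈x
    ...   | refl = x-joined v∈K
    K∪x-clique u∈ v∈ u≢v | inj₂ u∈x | inj₂ v∈x =
      contradiction (trans (x∈⁅y⁆⇒x≡y x u∈x) (≡-sym (x∈⁅y⁆⇒x≡y x v∈x))) u≢v

  starring-good : ∀ {c p} → Good a c → Valid c p → Good a {G = G} (starring c x p)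
  starring-good {c} {p} good valid i {K} K-clique with x ∈? K
  ... | no x∉K = good i λ u∈ v∈ u≢v → let e , eq = K-clique u∈ v∈ u≢v in
          e , trans (≡-sym (star-off (col c) p (λ { refl → x∉K u∈ }) (λ { refl → x∉K v∈ }))) eq
  ... | yes x∈K = subst (_≤ suc (a i)) (x∈p⇒1+∣p-x∣≡∣p∣ x∈K) (s≤s (valid i {K - x}
          (λ v∈ → let e , eq = K-clique x∈K (x∈p-y⇒x∈p v∈) (≢-sym (x∈p-y⇒x≢y v∈)) in
            ∈part⁺ (∈nbrs⁺ G e) (trans (≡-sym (star-at (col c) x p)) eq))
          (λ u∈ v∈ u≢v → let e , eq = K-clique (x∈p-y⇒x∈p u∈) (x∈p-y⇒x∈p v∈) u≢v in
            e , trans (≡-sym (star-off (col c) p (x∈p-y⇒x≢y u∈) (x∈p-y⇒x≢y v∈))) eq)))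

  -- Criticality is applied to `c` with the edges at `x` recoloured by `p`. The common clique avoids
  -- `x`, so its edges and those to `y` keep their colours under `c`.
  saturated : ∀ {c p y} → Good a c → NonNbr G x y → Valid c p → ∀ i → ∃[ K ] K ⊆ part N p i
    × Clique (E c i) K × a i ≤ size K × (∀ {v} → v ∈ K → E c i y v)
  saturated {c} {p} {y} good non@(x≢y , _) valid i with crit non {starring c x p} (starring-good {c} good valid) i
  ... | K , K-clique , a≤K , common = K ,
    (λ v∈K → let e , eq = proj₁ (common v∈K) in ∈part⁺ (∈nbrs⁺ G e) (trans (≡-sym (star-at (col c) x p)) eq)) ,
    (λ u∈K v∈K u≢v → off (≢x u∈K) (≢x v∈K) (K-clique u∈K v∈K u≢v)) , a≤K ,
    λ v∈K → off (≢-sym x≢y) (≢x v∈K) (proj₂ (common v∈K))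
    where
    ≢x : ∀ {v} → v ∈ K → v ≢ x
    ≢x v∈K = ≢-sym (adj-≢ G (proj₁ (proj₁ (common v∈K))))

    off : ∀ {u v} → u ≢ x → v ≢ x → Edge G (star (col c) x p) i u v → E c i u v
    off u≢x v≢x (e , eq) = e , trans (≡-sym (star-off (col c) p u≢x v≢x)) eq

  recolour-inside : ∀ {c y z i j u v} → y ∉ N → u ∈ N → v ∈ N → E (recolouring c y z i) j u v → E c j u v
  recolour-inside {c} {y} {z} {i} {u = u} {v} y∉N u∈N v∈N (e , eq) with recolour-other c y z i {u} {v}
  ... | inj₁ (inj₁ (refl , _)) = contradiction u∈N y∉N
  ... | inj₁ (inj₂ (_ , refl)) = contradiction v∈N y∉N
  ... | inj₂ same = e , trans (≡-sym same) eq

  -- Validity depends only on edges inside `N`, and a pair containing `y` is not one of them.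
  recolour-valid : ∀ {c p y z i} → y ∉ N → Valid c p → Valid (recolouring c y z i) p
  recolour-valid {c} y∉N valid j K⊆ K-clique = valid j K⊆ λ u∈ v∈ u≢v →
    recolour-inside {c} y∉N (proj₁ (∈part⁻ (K⊆ u∈))) (proj₁ (∈part⁻ (K⊆ v∈))) (K-clique u∈ v∈ u≢v)

-- The neighbourhood of a vertex with a non-neighbour, and the exceptional case of two colours.

module Extremal {n k : ℕ} (G : Graph n) (a : Fin k → ℕ) (a≥1 : ∀ i → 1 ≤ a i)
  (crit : ∀ {x y} → NonNbr G x y → {c : Colouring G k} → Good a c → ∀ i → CommonClique a c i x y)
  {x y : Fin n} (non-y : NonNbr G x y) (c : Colouring G k) (good : Good a c) where

  open Recolour G a a≥1 crit x
  module P = Partition (E c) (edge? G (col c)) (E-sym c) (E-unique c) a a≥1 N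
  open P using (Pivot; reassign-valid; large-nonempty; valid-⊆)

  large-parts : ∀ {p} → Valid c p → ∀ i → P.Large i (part N p i)
  large-parts valid i with saturated {c} good non-y valid i
  ... | K , K⊆ , K-clique , a≤K , _ = K , K⊆ , K-clique , a≤K

  open P.Saturated large-parts

  pair-sizes : ∀ {i j} → i ≢ j →
    (a i + a i) + (a j + a j) ≤ suc (size (part N (col c x) i) + size (part N (col c x) j))
  pair-sizes = pair-bound (own-valid {c} good)

  -- The hypothesis a r ≡ 1 says that the forbidden red cliques are triangles.
  module TwoColours {r b : Fin k} (r≢b : r ≢ b) (colours : ∀ i → i ≡ r ⊎ i ≡ b) (a-r : a r ≡ 1)
    (small : size N ≤ suc (a b + a b)) where

    Red Blue : Fin n → Fin n → Set
    Red = E c r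
    Blue = E c b

    not-red-and-blue : ∀ {u v} → Red u v → ¬ Blue u v
    not-red-and-blue red blue = r≢b (E-unique c red blue)

    no-red-triangle : ∀ {u v w} → Red u v → Red v w → ¬ Red u w
    no-red-triangle {u} {v} {w} uv vw uw = <⇒≱ three (subst (λ m → size T ≤ suc m) a-r (good r T-clique))
      where
      T = (⁅ u ⁆ ∪ ⁅ v ⁆) ∪ ⁅ w ⁆

      ∈T⁻ : ∀ {z} → z ∈ T → (z ≡ u ⊎ z ≡ v) ⊎ z ≡ w
      ∈T⁻ z∈ with x∈p∪q⁻ (⁅ u ⁆ ∪ ⁅ v ⁆) _ z∈
      ... | inj₂ z∈w = inj₂ (x∈⁅y⁆⇒x≡y w z∈w)
      ... | inj₁ z∈uv with x∈p∪q⁻ ⁅ u ⁆ _ z∈uv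
      ...   | inj₁ z∈u = inj₁ (inj₁ (x∈⁅y⁆⇒x≡y u z∈u))
      ...   | inj₂ z∈v = inj₁ (inj₂ (x∈⁅y⁆⇒x≡y v z∈v))

      T-clique : Clique Red T
      T-clique z∈ z′∈ z≢z′ with ∈T⁻ z∈ | ∈T⁻ z′∈
      ... | inj₁ (inj₁ refl) | inj₁ (inj₁ refl) = contradiction refl z≢z′
      ... | inj₁ (inj₁ refl) | inj₁ (inj₂ refl) = uv
      ... | inj₁ (inj₁ refl) | inj₂ refl = uw
      ... | inj₁ (inj₂ refl) | inj₁ (inj₁ refl) = E-sym c uv
      ... | inj₁ (inj₂ refl) | inj₁ (inj₂ refl) = contradiction refl z≢z′
      ... | inj₁ (inj₂ refl) | inj₂ refl = vw
      ... | inj₂ refl | inj₁ (inj₁ refl) = E-sym c uw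
      ... | inj₂ refl | inj₁ (inj₂ refl) = E-sym c vw
      ... | inj₂ refl | inj₂ refl = contradiction refl z≢z′

      three : 2 < size T
      three = ≤-trans (s≤s (≤-trans (s≤s (≤-reflexive (≡-sym (∣⁅x⁆∣≡1 u))))
        (p⊂q⇒∣p∣<∣q∣ {p = ⁅ u ⁆} {q = ⁅ u ⁆ ∪ ⁅ v ⁆} (p⊆p∪q _ , v , q⊆p∪q ⁅ u ⁆ _ (x∈⁅x⁆ v) ,
          λ v∈u → adj-≢ G (proj₁ uv) (≡-sym (x∈⁅y⁆⇒x≡y u v∈u))))))
        (p⊂q⇒∣p∣<∣q∣ {p = ⁅ u ⁆ ∪ ⁅ v ⁆} {q = T} (p⊆p∪q _ , w , q⊆p∪q (⁅ u ⁆ ∪ ⁅ v ⁆) _ (x∈⁅x⁆ w) ,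
          λ w∈uv → [ (λ w∈u → adj-≢ G (proj₁ uw) (≡-sym (x∈⁅y⁆⇒x≡y u w∈u))) ,
                     (λ w∈v → adj-≢ G (proj₁ vw) (≡-sym (x∈⁅y⁆⇒x≡y v w∈v))) ]′ (x∈p∪q⁻ ⁅ u ⁆ _ w∈uv)))

    nbr-or-non : ∀ v → v ∈ N ⊎ (v ≡ x ⊎ NonNbr G x v)
    nbr-or-non v with x ≟ v | adj G x v in eq
    ... | yes refl | _ = inj₂ (inj₁ refl)
    ... | no _ | true = inj₁ (∈nbrs⁺ G eq)
    ... | no x≢v | false = inj₂ (inj₂ (x≢v , refl))

    single : Fin n → Fin n → Fin k
    single w = reassign (λ _ → b) w r

    double : Fin n → Fin n → Fin n → Fin k
    double w v = reassign (single w) v r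

    single-red⁻ : ∀ {w u} → u ∈ part N (single w) r → u ≡ w
    single-red⁻ {w} {u} u∈ with u ≟ w | proj₂ (∈part⁻ u∈)
    ... | yes u≡w | _ = u≡w
    ... | no _ | b≡r = contradiction (≡-sym b≡r) r≢b

    single-blue⁻ : ∀ {w u} → u ∈ part N (single w) b → u ≢ w
    single-blue⁻ {w} {u} u∈ with u ≟ w | proj₂ (∈part⁻ u∈)
    ... | yes _ | r≡b = contradiction r≡b r≢b
    ... | no u≢w | _ = u≢w

    double-red⁻ : ∀ {w v u} → u ∈ part N (double w v) r → u ≡ w ⊎ u ≡ v
    double-red⁻ {w} {v} {u} u∈ with u ≟ v | u ≟ w | proj₂ (∈part⁻ u∈)
    ... | yes u≡v | _ | _ = inj₂ u≡v
    ... | no _ | yes u≡w | _ = inj₁ u≡w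
    ... | no _ | no _ | b≡r = contradiction (≡-sym b≡r) r≢b

    double-blue⁺ : ∀ {w v u} → u ∈ N → u ≢ w → u ≢ v → u ∈ part N (double w v) b
    double-blue⁺ {w} u∈N u≢w u≢v =
      ∈part⁺ u∈N (trans (reassign-≢ (single w) r u≢v) (reassign-≢ (λ _ → b) r u≢w))

    double-blue⁻ : ∀ {w v u} → u ∈ part N (double w v) b → u ∈ N × u ≢ w × u ≢ v
    double-blue⁻ {w} {v} {u} u∈ with ∈part⁻ u∈
    ... | u∈N , eq with u ≟ v | u ≟ w
    ...   | yes _ | _ = contradiction eq r≢b
    ...   | no _ | yes _ = contradiction eq r≢b
    ...   | no u≢v | no u≢w = u∈N , u≢w , u≢v

    -- Two red vertices in `N` make the blue part small enough to have a pivot.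
    small-without-two : ∀ {S v w} → v ∈ N → w ∈ N → v ≢ w → S ⊆ N → v ∉ S → w ∉ S → size S < a b + a b
    small-without-two {S} {v} {w} v∈N w∈N v≢w S⊆N v∉S w∉S = s≤s⁻¹ (begin
      2 + size S             ≤⟨ s≤s (s≤s (p⊆q⇒∣p∣≤∣q∣ S⊆N-v-w)) ⟩
      2 + size (N - v - w)   ≡⟨ cong suc (x∈p⇒1+∣p-x∣≡∣p∣ (x∈p∧x≢y⇒x∈p-y w∈N (≢-sym v≢w))) ⟩
      1 + size (N - v)       ≡⟨ x∈p⇒1+∣p-x∣≡∣p∣ v∈N ⟩
      size N                 ≤⟨ small ⟩
      suc (a b + a b)        ∎)
      where
      open ≤-Reasoning

      S⊆N-v-w : S ⊆ N - v - w
      S⊆N-v-w u∈S =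
        x∈p∧x≢y⇒x∈p-y (x∈p∧x≢y⇒x∈p-y (S⊆N u∈S) λ { refl → v∉S u∈S }) λ { refl → w∉S u∈S }

    -- The red class is at most `w` alone, so the nonempty common red clique of `x` and `z` consists
    -- of `w`.
    single-red : ∀ {c w z} → Good a c → Valid c (single w) → NonNbr G x z → E c r z w
    single-red {c} good valid non with saturated {c} good non valid r
    ... | K , K⊆ , _ , a≤K , common with large-nonempty r a≤K
    ... | v , v∈K = subst (E c r _) (single-red⁻ (K⊆ v∈K)) (common v∈K)

    single-red-to : ∀ {w z} → Valid c (single w) → NonNbr G x z → Red z w
    single-red-to = single-red {c} good

    single-∈ : ∀ {w} → Valid c (single w) → w ∈ N
    single-∈ valid with saturated {c} good non-y valid r
    ... | K , K⊆ , _ , a≤K , _ with large-nonempty r a≤K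
    ... | v , v∈K = subst (_∈ N) (single-red⁻ (K⊆ v∈K)) (proj₁ (∈part⁻ (K⊆ v∈K)))

    double-valid : ∀ {w v} → Valid c (single w) → ¬ Red w v → Valid c (double w v)
    double-valid {w} {v} valid ¬wv = reassign-valid v r valid λ K⊆ _ a≤K →
      let u , u∈K = large-nonempty r a≤K
      in u , u∈K , λ uv → ¬wv (subst (λ z → Red z v) (single-red⁻ (K⊆ u∈K)) uv)

    double-pivot : ∀ {w v} → w ∈ N → v ∈ N → w ≢ v → Valid c (double w v) →
      ∃[ z ] z ∈ part N (double w v) b × Pivot (double w v) b z
    double-pivot w∈N v∈N w≢v valid = pivot b valid
      (small-without-two w∈N v∈N w≢v (λ u∈ → proj₁ (∈part⁻ u∈))
        (λ w∈ → proj₁ (proj₂ (double-blue⁻ w∈)) refl) (λ v∈ → proj₂ (proj₂ (double-blue⁻ v∈)) refl))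

    -- While two vertices are red, the blue part is small and one red vertex can be pulled into it;
    -- saturation keeps the red part nonempty.
    single-valid-exists : ∃[ w ] Valid c (single w)
    single-valid-exists = loop _ (own-valid {c} good) ≤-refl
      where
      loop : ∀ m {p} → Valid c p → size (part N p r) ≤ m → ∃[ w ] Valid c (single w)
      loop m {p} valid r≤m with saturated {c} good non-y valid r
      ... | K , K⊆ , _ , a≤K , _ with large-nonempty r a≤K
      ... | w , w∈K with any? (λ u → (u ∈? part N p r) ×-dec ¬? (u ≟ w))
      ... | no none = w , valid-⊆ valid single⊆
        where
        single⊆ : ∀ i → part N (single w) i ⊆ part N p i
        single⊆ i u∈ with colours i
        ... | inj₁ refl = subst (_∈ part N p r) (≡-sym (single-red⁻ u∈)) (K⊆ w∈K)
        ... | inj₂ refl with colours (p _)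
        ...   | inj₁ p≡r = contradiction (_ , ∈part⁺ (proj₁ (∈part⁻ u∈)) p≡r , single-blue⁻ u∈) none
        ...   | inj₂ p≡b = ∈part⁺ (proj₁ (∈part⁻ u∈)) p≡b
      loop m {p} valid r≤m | K , K⊆ , _ , a≤K , _ | w , w∈K | yes (u , u∈ , u≢w) = descend m r≤m
        where
        not-blue : ∀ {v} → v ∈ part N p r → v ∉ part N p b
        not-blue v∈r v∈b = r≢b (trans (≡-sym (proj₂ (∈part⁻ v∈r))) (proj₂ (∈part⁻ v∈b)))

        pulled : ∃[ q ] Valid c q
          × size (part N q b) ≤ suc (size (part N p b)) × size (part N q r) < size (part N p r)
        pulled = pull valid (small-without-two (proj₁ (∈part⁻ (K⊆ w∈K))) (proj₁ (∈part⁻ u∈)) (≢-sym u≢w)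
          (λ v∈ → proj₁ (∈part⁻ v∈)) (not-blue (K⊆ w∈K)) (not-blue u∈)) r≢b

        descend : ∀ m → size (part N p r) ≤ m → ∃[ w ] Valid c (single w)
        descend zero r≤0 = let _ , _ , _ , r< = pulled in contradiction (≤-trans r< r≤0) λ ()
        descend (suc m) r≤m = let _ , valid-q , _ , r< = pulled in loop m valid-q (s≤s⁻¹ (≤-trans r< r≤m))

    y∉N : y ∉ N
    y∉N = nonNbr-∉ G non-y

    not-adj-x : ∀ {i} → ¬ E c i y x
    not-adj-x (e , _) = y∉N (∈nbrs⁺ G (trans (sym G x y) e))

    -- A blue clique preventing yu from being switched from red to blue would contain the pivot z,
    -- which is red to u. After the switch x and y have no common red neighbour under single u.
    pivot-not-red : ∀ {w v u z} → Valid c (single w) → Valid c (single v) → Valid c (single u) →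
      Pivot (double w v) b z → ¬ Red z u
    pivot-not-red {w} {v} {u} {z} valid-w valid-v valid-u pivot-z zu =
      r≢b (trans (≡-sym (proj₂ yu-still-red)) (recolour-pair c y u b))
      where
      yu : Red y u
      yu = single-red-to valid-u non-y

      none : ¬ CommonClique a c b y u
      none (L , L-clique , a≤L , common) =
        not-red-and-blue zu (E-sym c (proj₂ (common (pivot-z L⊆ L-clique a≤L))))
        where
        -- `L` is blue to `y` and `u`: this excludes `w` and `v`, which are red to `y`, and the
        -- non-neighbours of `x`, which are red to `u`.
        L⊆ : L ⊆ part N (double w v) b
        L⊆ {t} t∈L with nbr-or-non t
        ... | inj₁ t∈N = double-blue⁺ t∈N
                (λ { refl → not-red-and-blue (single-red-to valid-w non-y) (proj₁ (common t∈L)) })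
                (λ { refl → not-red-and-blue (single-red-to valid-v non-y) (proj₁ (common t∈L)) })
        ... | inj₂ (inj₁ refl) = contradiction (proj₁ (common t∈L)) not-adj-x
        ... | inj₂ (inj₂ non-t) = contradiction (E-sym c (proj₂ (common t∈L)))
                (not-red-and-blue (single-red-to valid-u non-t))

      switched-good : Good a {G = G} (recolouring c y u b)
      switched-good = recolouring-good a {c = c} good (adj-≢ G (proj₁ yu)) b none
      yu-still-red : Edge G (recolour c y u b) r y u
      yu-still-red = single-red {recolouring c y u b} switched-good (recolour-valid {c} y∉N valid-u) non-y

    -- Both `w` and `v` are red to `y`, so a red `wv` would close a red triangle.
    double-of-singles : ∀ {w v} → Valid c (single w) → Valid c (single v) → Valid c (double w v)
    double-of-singles valid-w valid-v = double-valid valid-w λ wv →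
      no-red-triangle (single-red-to valid-w non-y) wv (single-red-to valid-v non-y)

    -- The blue pivot under `double w v` needs a red neighbour in the red part, but only `w` and `v`
    -- are available and both are excluded.
    no-two-singles : ∀ {w v} → w ≢ v → Valid c (single w) → ¬ Valid c (single v)
    no-two-singles {w} {v} w≢v valid-w valid-v =
      from-pivot (double-pivot (single-∈ valid-w) (single-∈ valid-v) w≢v (double-of-singles valid-w valid-v))
      where
      from-neighbour : ∀ {z u} → Pivot (double w v) b z → u ≡ w ⊎ u ≡ v → ¬ Red z u
      from-neighbour pivot-z (inj₁ refl) = pivot-not-red valid-w valid-v valid-w pivot-z
      from-neighbour pivot-z (inj₂ refl) = pivot-not-red valid-w valid-v valid-v pivot-z

      from-pivot : ¬ (∃[ z ] z ∈ part N (double w v) b × Pivot (double w v) b z)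
      from-pivot (_ , _ , pivot-z) =
        let _ , u∈ , zu = pivot-neighbour (double-of-singles valid-w valid-v) pivot-z r≢b
        in from-neighbour pivot-z (double-red⁻ u∈) zu

    Partner : Fin n → Fin n → Fin n → Set
    Partner w v z = z ∈ N × ¬ Red w z
      × (∀ {K} → K ⊆ N → w ∉ K → Clique Blue K → a b ≤ size K → v ∈ K ⊎ z ∈ K)

    -- The partner is the blue pivot under `double w v`: a large blue clique avoiding both `w` and
    -- `v` lies in the blue part.
    partner : ∀ {w v} → Valid c (single w) → v ∈ N → w ≢ v → ¬ Red w v → ∃[ z ] Partner w v z
    partner {w} {v} valid-w v∈N w≢v ¬wv = from-pivot (double-pivot (single-∈ valid-w) v∈N w≢v valid)
      where
      valid : Valid c (double w v)
      valid = double-valid valid-w ¬wv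

      agree : ∀ u → single v u ≡ reassign (double w v) w b u
      agree u with u ≟ w | u ≟ v
      ... | yes refl | yes refl = contradiction refl w≢v
      ... | yes refl | no _ = refl
      ... | no _ | yes _ = refl
      ... | no _ | no _ = refl

      single⊆ : ∀ {i} → part N (single v) i ⊆ part N (reassign (double w v) w b) i
      single⊆ {x = u} u∈ = let u∈N , eq = ∈part⁻ u∈ in ∈part⁺ u∈N (trans (≡-sym (agree u)) eq)

      cover : ∀ {z} → Pivot (double w v) b z →
        ∀ {K} → K ⊆ N → w ∉ K → Clique Blue K → a b ≤ size K → v ∈ K ⊎ z ∈ K
      cover pivot-z {K} K⊆N w∉K K-clique a≤K with v ∈? K
      ... | yes v∈K = inj₁ v∈K
      ... | no v∉K = inj₂ (pivot-z
              (λ u∈K → double-blue⁺ (K⊆N u∈K) (λ { refl → w∉K u∈K }) (λ { refl → v∉K u∈K })) K-clique a≤K)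

      -- If `wz` were red, `w` could be pulled back to blue, making `single v` valid alongside
      -- `single w`.
      not-red : ∀ {z} → Pivot (double w v) b z → ¬ Red w z
      not-red pivot-z wz = no-two-singles w≢v valid-w
        (valid-⊆ (pull-valid valid pivot-z r≢b (E-sym c wz)) λ i → single⊆ {i})

      from-pivot : ∃[ z ] z ∈ part N (double w v) b × Pivot (double w v) b z → ∃[ z ] Partner w v z
      from-pivot (z , z∈ , pivot-z) with double-blue⁻ z∈
      ... | z∈N , _ = z , z∈N , not-red pivot-z , cover pivot-z

    -- With `z` a partner of `v`, saturation under `double w z` gives a large blue clique joined in
    -- blue to `y`. It avoids `w` and `z`, hence contains `v`.
    blue-to-non-red : ∀ {w v} → Valid c (single w) → v ∈ N → w ≢ v → ¬ Red w v → Blue y v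
    blue-to-non-red {w} {v} valid-w v∈N w≢v ¬wv = from-partner (partner valid-w v∈N w≢v ¬wv)
      where
      from-partner : ∃[ z ] Partner w v z → Blue y v
      from-partner (z , _ , ¬wz , cover)
        with saturated {c} good non-y (double-valid valid-w ¬wz) b
      ... | K , K⊆ , K-clique , a≤K , common
        with cover (λ u∈ → proj₁ (double-blue⁻ (K⊆ u∈))) (λ w∈ → proj₁ (proj₂ (double-blue⁻ (K⊆ w∈))) refl)
               K-clique a≤K
      ... | inj₁ v∈K = common v∈K
      ... | inj₂ z∈K = contradiction refl (proj₂ (proj₂ (double-blue⁻ (K⊆ z∈K))))

    -- The edge yz can be switched from blue to red. Then, under double w v, every large clique in
    -- the blue part contains z, so x and y have no common blue clique left.
    partner-impossible : ∀ {w v z} → Valid c (single w) → ¬ Red w v → ¬ Partner w v z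
    partner-impossible {w} {v} {z} valid-w ¬wv (z∈N , ¬wz , cover) =
      no-blue-clique (saturated {recolouring c y z r} switched-good non-y
        (recolour-valid {c} y∉N (double-valid valid-w ¬wv)) b)
      where
      yw : Red y w
      yw = single-red-to valid-w non-y

      -- A common red neighbour `q` of `y` and `z` is neither `x` nor `w`. If `q` is a non-neighbour
      -- of `x`, or `wq` is red, then `y`, `q`, `w` form a red triangle; otherwise `yq` is blue.
      none : ¬ CommonClique a c r y z
      none (L , _ , a≤L , common) with large-nonempty r a≤L
      ... | q , q∈L with common q∈L | nbr-or-non q
      ... | yq , _ | inj₂ (inj₁ refl) = not-adj-x yq
      ... | yq , _ | inj₂ (inj₂ non-q) = no-red-triangle yq (single-red-to valid-w non-q) yw
      ... | yq , zq | inj₁ q∈N with w ≟ q | edge? G (col c) r w q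
      ...   | yes refl | _ = ¬wz (E-sym c zq)
      ...   | no _ | yes wq = no-red-triangle yw wq yq
      ...   | no w≢q | no ¬wq = not-red-and-blue yq (blue-to-non-red valid-w q∈N w≢q ¬wq)

      switched-good : Good a {G = G} (recolouring c y z r)
      switched-good = recolouring-good a {c = c} good (λ { refl → y∉N z∈N }) r none

      no-blue-clique : ¬ (∃[ K ] K ⊆ part N (double w v) b × Clique (E (recolouring c y z r) b) K
        × a b ≤ size K × (∀ {u} → u ∈ K → E (recolouring c y z r) b y u))
      no-blue-clique (K , K⊆ , K-clique , a≤K , common) =
        [ (λ v∈K → proj₂ (proj₂ (double-blue⁻ (K⊆ v∈K))) refl) ,
          (λ z∈K → r≢b (trans (≡-sym (recolour-pair c y z r)) (proj₂ (common z∈K)))) ]′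
        (cover K⊆N (λ w∈ → proj₁ (proj₂ (double-blue⁻ (K⊆ w∈))) refl)
          (λ u∈ v∈ u≢v → recolour-inside {c} y∉N (K⊆N u∈) (K⊆N v∈) (K-clique u∈ v∈ u≢v)) a≤K)
        where
        K⊆N : K ⊆ N
        K⊆N u∈ = proj₁ (double-blue⁻ (K⊆ u∈))

    pivot-single : ∀ w → Pivot (single w) r w
    pivot-single w {K} K⊆ _ a≤K with large-nonempty r a≤K
    ... | u , u∈K = subst (_∈ K) (single-red⁻ (K⊆ u∈K)) u∈K

    -- The only red vertex `w` is the red pivot, so it has a blue neighbour `v` in the blue part. As
    -- `wv` is not red, `v` has a partner, which is impossible.
    impossible : ⊥
    impossible = from-single single-valid-exists
      where
      from-neighbour : ∀ {w} → Valid c (single w) → ¬ (∃[ v ] v ∈ part N (single w) b × Blue w v)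
      from-neighbour valid-w (v , v∈ , wv) = partner-impossible valid-w ¬wv (proj₂
        (partner valid-w (proj₁ (∈part⁻ v∈)) (≢-sym (single-blue⁻ v∈)) ¬wv))
        where
        ¬wv : ¬ Red _ v
        ¬wv red = not-red-and-blue red wv

      from-single : ¬ (∃[ w ] Valid c (single w))
      from-single (w , valid-w) = from-neighbour valid-w (pivot-neighbour valid-w (pivot-single w) (≢-sym r≢b))

-- The degree bound.

∑-const : ∀ m d → ∑ {m} (λ _ → d) ≡ m * d
∑-const zero d = refl
∑-const (suc m) d = cong (d +_) (∑-const m d)

two-colours : (l i : Fin 2) → i ≡ punchIn l zero ⊎ i ≡ l
two-colours zero zero = inj₂ refl
two-colours zero (suc zero) = inj₁ refl
two-colours (suc zero) zero = inj₁ refl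
two-colours (suc zero) (suc zero) = inj₂ refl

module MinDegree {m n : ℕ} (G : Graph n) (a : Fin (2 + m) → ℕ) (a≥1 : ∀ i → 1 ≤ a i)
  (crit : ∀ {x y} → NonNbr G x y → {c : Colouring G (2 + m)} → Good a c → ∀ i → CommonClique a c i x y)
  {x y : Fin n} (non-y : NonNbr G x y) (c : Colouring G (2 + m)) (good : Good a c) where

  open Extremal G a a≥1 crit non-y c good

  2∑≤ : ∑ a + ∑ a ≤ suc (size (nbrs G x))
  2∑≤ = subst₂ (λ s t → s ≤ suc t) (∑-distrib-+ a a) (∑-part (nbrs G x) (col c x))
    (∑-pair-bound (λ i → a i + a i) (λ i → size (part (nbrs G x) (col c x) i)) pair-sizes)

  -- If `a l + 2 ≤ ∑ a`, the general bound of twice `∑ a` minus 1 suffices. Otherwise there are two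
  -- colours, the other one forbids triangles, and failure would mean at most `2 * a l + 1`
  -- neighbours.
  size-bound : ∀ l → suc (a l + ∑ a) ≤ size (nbrs G x)
  size-bound l with surplus a a≥1 l
  ... | inj₂ 2≤rest = s≤s⁻¹ (≤-trans (≤-trans
          (≤-reflexive (solve 2 (λ a s → con 2 :+ (a :+ s) := (a :+ con 2) :+ s) refl (a l) (∑ a)))
          (+-monoˡ-≤ (∑ a) 2≤rest)) 2∑≤)
  ... | inj₁ (refl , a≡1) = ≰⇒> λ N≤ → TwoColours.impossible (punchInᵢ≢i l zero) (two-colours l) a≡1
          (≤-trans N≤ (≤-reflexive (trans
            (cong (a l +_) (trans (sum-remove {i = l} a) (cong (λ t → a l + (t + 0)) a≡1)))
            (solve 1 (λ a → a :+ (a :+ con 1) := con 1 :+ (a :+ a)) refl (a l)))))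

theorem1p8 : (k : ℕ) (2≤k : 2 ≤ k) (ts : Fin k → ℕ) →
    (∀ i → 3 ≤ ts i) → (∀ i j → i ≤ᶠ j → ts i ≤ ts j) →
    ∀ {n} (G : Graph n) → CoCritical G ts →
    minDegree≥ G ((ts (lastIdx k 2≤k) + sum (map ts (allFin k))) ∸ (2 * k + 1))
theorem1p8 (suc zero) (s≤s ())
theorem1p8 k@(suc (suc m)) 2≤k ts ts≥3 _ {n} G ((u , v , non-v) , ¬arrows , arrows) = min-degree
  where
  a : Fin k → ℕ
  a i = ts i ∸ 2

  ts≡ : ∀ i → ts i ≡ 2 + a i
  ts≡ i = ≡-sym (m+[n∸m]≡n (≤-trans (n≤1+n 2) (ts≥3 i)))

  l : Fin k
  l = lastIdx k 2≤k

  -- The twos in `ts i = 2 + a i` contribute `2 * k + 2`; subtracting `2 * k + 1` leaves the 1 in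
  -- `size-bound`.
  total : ts l + sum (map ts (allFin k)) ≡ (2 * k + 1) + suc (a l + ∑ a)
  total = trans (cong₂ _+_ (ts≡ l) (trans (sum-map-allFin ts) (trans (sum-cong-≗ ts≡)
      (trans (∑-distrib-+ (λ _ → 2) a) (cong (_+ ∑ a) (∑-const k 2))))))
    (solve 3 (λ k a s → (con 2 :+ a) :+ (k :* con 2 :+ s) := (con 2 :* k :+ con 1) :+ (con 1 :+ (a :+ s)))
      refl k (a l) (∑ a))

  bound : ∀ {x y} → NonNbr G x y → (ts l + sum (map ts (allFin k))) ∸ (2 * k + 1) ≤ degree G x
  bound {x} non = decidable-stable (_ ≤? _) λ ¬bound → good-colouring a G ts≡ ¬arrows λ c good →
    ¬bound (m≤n+o⇒m∸n≤o _ (2 * k + 1) (subst₂ (λ s d → s ≤ (2 * k + 1) + d) (≡-sym total) (≡-sym (degree≡size G x))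
      (+-monoʳ-≤ (2 * k + 1) (MinDegree.size-bound G a (λ i → ∸-monoˡ-≤ 2 (ts≥3 i))
        (λ (x≢y , e) {c} → critical a G ts≡ x≢y (arrows _ _ x≢y e) {c}) non c good l))))

  min-degree : minDegree≥ G ((ts l + sum (map ts (allFin k))) ∸ (2 * k + 1))
  min-degree x with any? (λ y → ¬? (x ≟ y) ×-dec (adj G x y Bool.≟ false))
  ... | yes (_ , non) = bound non
  -- A vertex adjacent to all others has maximum degree, so it inherits the bound from the vertex
  -- `u` given by non-completeness.
  ... | no none = ≤-trans (bound non-v) (degree-full G x full u)
    where
    full : ∀ y → x ≢ y → adj G x y ≡ true
    full y x≢y with adj G x y in eq
    ... | true = refl
    ... | false = contradiction (y , x≢y , eq) none
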